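{- Let $(\mathcal{A},\mathbf{m})$ be a cyclic sequencing problem with $n=2$. Then, in the cycle returned by the Euclidean Sequencing Algorithm, the more abundant symbol is arranged in such a way that $|m_1-m_2|$ of its instances have $\Delta_j=1$, while its remaining instances have $\Delta_j=2$.
   Context: Here $\mathbb{N}=\{1,2,\ldots\}$. A cyclic sequencing problem with $n=2$ is a couple $(\mathcal{A},\mathbf{m})$, where $\mathcal{A}=[a_1,a_2]$ is an alphabet of two distinct symbols and $\mathbf{m}=(m_1,m_2)\in\mathbb{N}^2$ is the vector of prescribed multiplicities. Put $N:=m_1+m_2$ and $\mathbb{Z}_N:=\mathbb{Z}/N\mathbb{Z}$. A cycle is a map $C:\mathbb{Z}_N\to\mathcal{A}$, with $C_j:=C([j]_N)$; the positions $j$ with $C_j=a_k$ are the instances of $a_k$. A word of length $N$ over $\mathcal{A}$ is identified with the cycle whose values $C_1,\ldots,C_N$ are its successive letters. For a cycle $C$ and a position $j$, $\Delta_j$ is the distance in steps from position $j$ to the next instance of the same symbol around the cycle, i.e. the least integer $d\ge 1$ with $C_{j+d}=C_j$ (indices modulo $N$); so $\Delta_j=N$ if the symbol appears only once. Euclidean Sequencing Algorithm (ESA). Words are multiplied by concatenation, and $W^q$ is the $q$-fold concatenation of $W$. Let $A_0$ be the symbol of higher multiplicity (the more abundant symbol) and $B_0$ the other one (the less abundant symbol); if $m_1=m_2$, either choice is allowed. Let $P_1$ and $D_1$ be the multiplicities of $A_0$ and $B_0$. For $i=1,2,\ldots$ set $Q_i:=\lfloor P_i/D_i\rfloor$, $R_i:=P_i-Q_iD_i$,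 $A_i:=A_{i-1}^{Q_i}B_{i-1}$, $B_i:=A_{i-1}$. If $R_i>0$, set $P_{i+1}:=D_i$, $D_{i+1}:=R_i$ and continue with $i+1$; if $R_i=0$, stop and return the cycle $C:=A_i^{D_i}$. -}

module Defs where

open import Data.Fin using (Fin; toℕ; cast; opposite)
open import Data.Fin.Patterns using (0F; 1F)
open import Data.Fin.Properties using (toℕ-injective; toℕ-fromℕ<; toℕ<n; toℕ-cast; inj⇒≟)
open import Data.List using (List; _++_; [_]; concat; replicate; length; lookup; filter; allFin)
open import Data.List.Properties using (length-++)
open import Data.Nat
open import Data.Nat.DivMod using (_mod_; m%n<n; m≡m%n+[m/n]*n; m<n⇒m%n≡m; [m+n]%n≡m%n; %-distribˡ-+; m%n%n≡m%n)
open import Data.Nat.Induction using (<-wellFounded; <-rec)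
open import Data.Nat.Properties
open import Data.Nat.Solver using (module +-*-Solver)
open import Data.Product using (∃; _×_; _,_; proj₁)
open import Function.Bundles using (_↔_; Inverse)
open import Function.Properties.Inverse using (↔⇒↣; ↔-sym)
open import Induction.WellFounded using (Acc; acc)
open import Level using (Level)
open import Relation.Binary.Definitions using (DecidableEquality)
open import Relation.Binary.PropositionalEquality hiding ([_])
open import Relation.Nullary using (yes; no)
open import Relation.Nullary.Decidable using (_×-dec_)
open import Relation.Unary using (Pred; Decidable)

private
  variable
    a p : Level
    A : Set a

IsLeast : Pred ℕ p → Pred ℕ p
IsLeast P d = P d × (∀ {e} → P e → d ≤ e)

least : {P : Pred ℕ p} → Decidable P → ∀ n → P n → ∃ (IsLeast P)
least {P = P} P? = <-rec (λ n → P n → ∃ (IsLeast P)) step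
  where
  step : ∀ n → (∀ {m} → m < n → P m → ∃ (IsLeast P)) → P n → ∃ (IsLeast P)
  step n rec pn with anyUpTo? P? n
  ... | yes (m , m<n , pm) = rec m<n pm
  ... | no ¬below = n , pn , λ {e} pe → ≮⇒≥ λ e<n → ¬below (e , e<n , pe)

-- ℤ_N is represented by the residues Fin N.

Cycle : ℕ → Set a → Set a
Cycle N A = Fin N → A

module _ {N : ℕ} .{{_ : NonZero N}} where

  infix 9 _at_
  _at_ : Cycle N A → ℕ → A
  C at j = C (j mod N)

  count : {P : Pred (Fin N) p} → Decidable P → ℕ
  count P? = length (filter P? (allFin N))

  Returns : Cycle N A → Fin N → Pred ℕ _
  Returns C j d = 1 ≤ d × C at (toℕ j + d) ≡ C j

  returns-N : (C : Cycle N A) (j : Fin N) → Returns C j N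
  returns-N C j = >-nonZero⁻¹ N , cong C (toℕ-injective (begin
    toℕ ((toℕ j + N) mod N)  ≡⟨ toℕ-fromℕ< _ ⟩
    (toℕ j + N) % N          ≡⟨ [m+n]%n≡m%n (toℕ j) N ⟩
    toℕ j % N                ≡⟨ m<n⇒m%n≡m (toℕ<n j) ⟩
    toℕ j                    ∎))
    where open ≡-Reasoning

  nextReturn : DecidableEquality A → (C : Cycle N A) (j : Fin N) → ∃ (IsLeast (Returns C j))
  nextReturn _≟A_ C j =
    least (λ d → (1 ≤? d) ×-dec ((C at (toℕ j + d)) ≟A C j)) N (returns-N C j)

  Δ : DecidableEquality A → Cycle N A → Fin N → ℕ
  Δ _≟A_ C j = proj₁ (nextReturn _≟A_ C j)

  -- The letters of w are C₁ , … , C_N, so the residue 0 carries the last letter.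
  wordCycle : (w : List A) → length w ≡ N → Cycle N A
  wordCycle w eq x = lookup w (cast (sym eq) ((toℕ x + pred N) mod N))

  wordCycle-letter : (w : List A) (eq : length w ≡ N) (i : Fin (length w)) →
                     wordCycle w eq at suc (toℕ i) ≡ lookup w i
  wordCycle-letter w eq i = cong (lookup w) (toℕ-injective (begin
    toℕ (cast (sym eq) ((toℕ (s mod N) + pred N) mod N))  ≡⟨ toℕ-cast _ _ ⟩
    toℕ ((toℕ (s mod N) + pred N) mod N)  ≡⟨ toℕ-fromℕ< _ ⟩
    (toℕ (s mod N) + pred N) % N          ≡⟨ cong (λ r → (r + pred N) % N) (toℕ-fromℕ< (m%n<n s N)) ⟩
    (s % N + pred N) % N                  ≡⟨ %-distribˡ-+ (s % N) (pred N) N ⟩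
    (s % N % N + pred N % N) % N          ≡⟨ cong (λ r → (r + pred N % N) % N) (m%n%n≡m%n s N) ⟩
    (s % N + pred N % N) % N              ≡⟨ %-distribˡ-+ s (pred N) N ⟨
    (s + pred N) % N                      ≡⟨ cong (_% N) (trans (sym (+-suc (toℕ i) (pred N))) (cong (toℕ i +_) (suc-pred N))) ⟩
    (toℕ i + N) % N                       ≡⟨ [m+n]%n≡m%n (toℕ i) N ⟩
    toℕ i % N                             ≡⟨ m<n⇒m%n≡m (subst (toℕ i <_) eq (toℕ<n i)) ⟩
    toℕ i                                 ∎))
    where
    open ≡-Reasoning
    s : ℕ
    s = suc (toℕ i)

infixr 8 _^ʷ_
_^ʷ_ : List A → ℕ → List A
w ^ʷ q = concat (replicate q w)

length-^ʷ : (w : List A) (q : ℕ) → length (w ^ʷ q) ≡ q * length w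
length-^ʷ w zero    = refl
length-^ʷ w (suc q) = trans (length-++ w) (cong (length w +_) (length-^ʷ w q))

-- esaFrom P D V W runs the algorithm from (Pᵢ , Dᵢ , Aᵢ₋₁ , Bᵢ₋₁) = (P , D , V , W);
-- continue D R V W receives (Dᵢ , Rᵢ , Aᵢ , Bᵢ).
esaFrom  : (P D : ℕ) .{{_ : NonZero D}} → List A → List A → Acc _<_ D → List A
continue : (D R : ℕ) → List A → List A → Acc _<_ R → List A

esaFrom P D V W (acc rs) =
  continue D (P % D) (V ^ʷ (P / D) ++ W) V (rs (m%n<n P D))

continue D zero      V W _  = V ^ʷ D
continue D R@(suc _) V W ac = esaFrom D R V W ac

length-esaFrom : (P D : ℕ) .{{_ : NonZero D}} (V W : List A) (ac : Acc _<_ D) →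
                 length (esaFrom P D V W ac) ≡ P * length V + D * length W
length-continue : (D R : ℕ) (V W : List A) (ac : Acc _<_ R) →
                  length (continue D R V W ac) ≡ D * length V + R * length W

length-esaFrom P D V W (acc rs) = begin
  length (continue D (P % D) (V ^ʷ (P / D) ++ W) V _)
    ≡⟨ length-continue D (P % D) (V ^ʷ (P / D) ++ W) V (rs (m%n<n P D)) ⟩
  D * length (V ^ʷ (P / D) ++ W) + P % D * v
    ≡⟨ cong (λ l → D * l + P % D * v) (trans (length-++ (V ^ʷ (P / D))) (cong (_+ w) (length-^ʷ V (P / D)))) ⟩
  D * (P / D * v + w) + P % D * v
    ≡⟨ solve 5 (λ d q r x y → d :* (q :* x :+ y) :+ r :* x := (r :+ q :* d) :* x :+ d :* y)
         refl D (P / D) (P % D) v w ⟩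
  (P % D + P / D * D) * v + D * w
    ≡⟨ cong (λ n → n * v + D * w) (m≡m%n+[m/n]*n P D) ⟨
  P * v + D * w ∎
  where
  open ≡-Reasoning
  open +-*-Solver
  v w : ℕ
  v = length V
  w = length W

length-continue D zero      V W _  = trans (length-^ʷ V D) (sym (+-identityʳ _))
length-continue D R@(suc _) V W ac = length-esaFrom D R V W ac

record CyclicSequencingProblem : Set₁ where
  field
    Symbol   : Set
    alphabet : Fin 2 ↔ Symbol
    m        : Fin 2 → ℕ
    m-pos    : ∀ k → NonZero (m k)

  symbol : Fin 2 → Symbol
  symbol = Inverse.to alphabet

  infix 4 _≟ˢ_
  _≟ˢ_ : DecidableEquality Symbol
  _≟ˢ_ = inj⇒≟ (↔⇒↣ (↔-sym alphabet))

  N : ℕ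
  N = m 0F + m 1F

  instance
    m-nonZero : ∀ {k} → NonZero (m k)
    m-nonZero {k} = m-pos k

    N-nonZero : NonZero N
    N-nonZero = >-nonZero (≤-trans (>-nonZero⁻¹ (m 0F)) (m≤m+n (m 0F) (m 1F)))

  -- Holds of both indices when the two multiplicities are equal.
  MoreAbundant : Fin 2 → Set
  MoreAbundant k = m (opposite k) ≤ m k

  -- The algorithm run with A₀ = symbol k and B₀ the other symbol.
  esaWord : Fin 2 → List Symbol
  esaWord k = esaFrom (m k) (m (opposite k)) [ symbol k ] [ symbol (opposite k) ] (<-wellFounded _)

  length-esaWord : ∀ k → length (esaWord k) ≡ N
  length-esaWord k = trans
    (length-esaFrom (m k) (m (opposite k)) [ symbol k ] [ symbol (opposite k) ] (<-wellFounded _))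
    (trans (cong₂ _+_ (*-identityʳ (m k)) (*-identityʳ (m (opposite k)))) (sum k))
    where
    sum : ∀ k → m k + m (opposite k) ≡ N
    sum 0F = refl
    sum 1F = +-comm (m 1F) (m 0F)

  ESA : (k : Fin 2) → MoreAbundant k → Cycle N Symbol
  ESA k _ = wordCycle (esaWord k) (length-esaWord k)

{-# OPTIONS --safe #-}

-- From the first step on, every word of the algorithm is a product of the blocks a and ab, where a
-- is the more abundant symbol: A₁ = a^(Q₁-1)·ab and B₁ = a. Hence, around the cycle, every b is
-- followed by an a. The a of a block ab has distance 2, and a block a is followed by the initial a
-- of another block, so it has distance 1. Each b uses up one a, which leaves m(a) − m(b) blocks a.

module Submission where

open import Defs
open import Data.Empty using (⊥-elim)
open import Data.Fin using (Fin; zero; suc; toℕ; fromℕ; inject₁; opposite)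
open import Data.Fin.Patterns using (0F; 1F)
open import Data.Fin.Properties using (toℕ-injective; toℕ-fromℕ; toℕ-fromℕ<; toℕ-inject₁; toℕ<n)
open import Data.List using (List; []; _∷_; [_]; _++_; length; lookup; filter; tabulate)
open import Data.Nat using (ℕ; zero; suc; pred; _+_; _*_; _∸_; _≤_; _<_; z≤n; s≤s; _/_; _%_; NonZero; ∣_-_∣; _≟_; >-nonZero)
open import Data.Nat.DivMod using (_mod_; m%n<n; [m+n]%n≡m%n; m≡m%n+[m/n]*n; m<n⇒m%n≡m; %-distribˡ-+; m%n%n≡m%n; m≥n⇒m/n>0)
open import Data.Nat.Induction using (<-wellFounded)
open import Data.Nat.Properties using (suc-pred; m+n∸n≡m; ≤-antisym; ≤∧≢⇒<; m≤n⇒∣n-m∣≡n∸m; m≤n⇒∣m-n∣≡n∸m; +-assoc; +-comm; +-identityʳ; +-cancelʳ-≡)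
open import Data.Nat.Solver using (module +-*-Solver)
open import Data.Product using (_×_; _,_; proj₁; proj₂)
open import Function using (_∘_)
open import Function.Bundles using (_⇔_; mk⇔; Equivalence; Injection)
open import Function.Properties.Inverse using (↔⇒↣)
open import Induction.WellFounded using (Acc; acc)
open import Relation.Binary.Definitions using (DecidableEquality)
open import Relation.Binary.PropositionalEquality using (_≡_; _≢_; refl; sym; trans; cong; cong₂; subst; ≢-sym; module ≡-Reasoning)
open import Relation.Nullary using (yes; no)
open import Relation.Nullary.Decidable using (_×-dec_)
open import Relation.Unary using (Decidable)

-- Products of the blocks a and ab.

-- The index n counts the blocks a only.
data Blocks {A : Set} (a : A) : ℕ → List A → Set where
  []     : Blocks a 0 []
  single : ∀ {n w} → Blocks a n w → Blocks a (suc n) (a ∷ w)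
  pair   : ∀ {n w b} → b ≢ a → Blocks a n w → Blocks a n (a ∷ b ∷ w)

module _ {A : Set} {a : A} where

  blocks-cast : ∀ {m n w} → m ≡ n → Blocks a m w → Blocks a n w
  blocks-cast refl ws = ws

  blocks-++ : ∀ {m n v w} → Blocks a m v → Blocks a n w → Blocks a (m + n) (v ++ w)
  blocks-++ []           ws = ws
  blocks-++ (single vs)  ws = single (blocks-++ vs ws)
  blocks-++ (pair b≢ vs) ws = pair b≢ (blocks-++ vs ws)

  blocks-^ʷ : ∀ {n w} q → Blocks a n w → Blocks a (q * n) (w ^ʷ q)
  blocks-^ʷ zero    ws = []
  blocks-^ʷ (suc q) ws = blocks-++ ws (blocks-^ʷ q ws)

  -- The number of blocks a is additive under concatenation, so it obeys the same linear recursion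
  -- as the length, and `P * v + D * w` is preserved by each division step.
  blocks-esaFrom : ∀ {v w V W} P D .{{_ : NonZero D}} (ac : Acc _<_ D) →
                   Blocks a v V → Blocks a w W → Blocks a (P * v + D * w) (esaFrom P D V W ac)
  blocks-continue : ∀ {v w V W} D R (ac : Acc _<_ R) →
                    Blocks a v V → Blocks a w W → Blocks a (D * v + R * w) (continue D R V W ac)

  blocks-esaFrom {v} {w} P D (acc rs) vs ws =
    blocks-cast eq
      (blocks-continue D (P % D) (rs (m%n<n P D)) (blocks-++ (blocks-^ʷ (P / D) vs) ws) vs)
    where
    open ≡-Reasoning
    open +-*-Solver
    eq : D * (P / D * v + w) + P % D * v ≡ P * v + D * w
    eq = begin
      D * (P / D * v + w) + P % D * v
        ≡⟨ solve 5 (λ d q r x y → d :* (q :* x :+ y) :+ r :* x := (r :+ q :* d) :* x :+ d :* y)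
             refl D (P / D) (P % D) v w ⟩
      (P % D + P / D * D) * v + D * w
        ≡⟨ cong (λ n → n * v + D * w) (m≡m%n+[m/n]*n P D) ⟨
      P * v + D * w ∎

  blocks-continue D zero      _  vs ws =
    blocks-cast (sym (+-identityʳ _)) (blocks-^ʷ D vs)
  blocks-continue D R@(suc _) ac vs ws = blocks-esaFrom D R ac vs ws

  blocks-A₁ : ∀ {b} → b ≢ a → ∀ q .{{_ : NonZero q}} → Blocks a (pred q) ([ a ] ^ʷ q ++ [ b ])
  blocks-A₁ b≢a (suc zero)      = pair b≢a []
  blocks-A₁ b≢a (suc q@(suc _)) = single (blocks-A₁ b≢a q)

  -- The starting word `[ b ]` is not a product of blocks, so the first division is carried out
  -- separately and the invariant takes over from A₁ and B₁.
  blocks-esa : ∀ {b} → b ≢ a → ∀ P D .{{_ : NonZero D}} → D ≤ P → (ac : Acc _<_ D) →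
               Blocks a (P ∸ D) (esaFrom P D [ a ] [ b ] ac)
  blocks-esa b≢a P D D≤P (acc rs) =
    blocks-cast (trans (sym (m+n∸n≡m singles D)) (cong (_∸ D) eq))
      (blocks-continue D (P % D) (rs (m%n<n P D)) (blocks-A₁ b≢a (P / D)) (single []))
    where
    instance
      -- `D ≤ P` makes the first quotient positive, so A₁ has an a to pair with its b.
      Q-nonZero : NonZero (P / D)
      Q-nonZero = >-nonZero (m≥n⇒m/n>0 D≤P)
    -- The result is made of `D` copies of A₁, with Q₁ - 1 blocks a each, and R₁ copies of B₁ = a.
    -- Adding the `D` letters a of the blocks ab gives all `P` of them.
    singles : ℕ
    singles = D * pred (P / D) + P % D * 1
    open ≡-Reasoning
    open +-*-Solver
    eq : singles + D ≡ P
    eq = begin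
      D * pred (P / D) + P % D * 1 + D
        ≡⟨ solve 3 (λ d q r → d :* q :+ r :* con 1 :+ d := r :+ (con 1 :+ q) :* d)
             refl D (pred (P / D)) (P % D) ⟩
      P % D + suc (pred (P / D)) * D
        ≡⟨ cong (λ q → P % D + q * D) (suc-pred (P / D)) ⟩
      P % D + P / D * D
        ≡⟨ m≡m%n+[m/n]*n P D ⟨
      P ∎

  -- Here `c` plays the letter before `w`. Inside `w`, a letter other than a closes a block ab, so
  -- the next letter opens a block; at index zero `w` itself opens a block, whatever `c` is.
  after-other : ∀ {n w} → Blocks a n w → ∀ c (i : Fin (length w)) →
                lookup (c ∷ w) (inject₁ i) ≢ a → lookup w i ≡ a
  after-other (single ws)  c zero          _  = refl
  after-other (single ws)  c (suc i)       ≢a = after-other ws a i ≢a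
  after-other (pair b≢ ws) c zero          _  = refl
  after-other (pair b≢ ws) c (suc zero)    ≢a = ⊥-elim (≢a refl)
  after-other (pair b≢ ws) c (suc (suc i)) ≢a = after-other ws _ i ≢a

  -- Counting adjacent pairs aa.

  module _ (_≟A_ : DecidableEquality A) where

    [_≡a] : A → ℕ
    [ x ≡a] with x ≟A a
    ... | yes _ = 1
    ... | no  _ = 0

    [a≡a] : [ a ≡a] ≡ 1
    [a≡a] with a ≟A a
    ... | yes _  = refl
    ... | no a≢a = ⊥-elim (a≢a refl)

    ≢⇒[≡a] : ∀ {x} → x ≢ a → [ x ≡a] ≡ 0
    ≢⇒[≡a] {x} x≢a with x ≟A a
    ... | yes x≡a = ⊥-elim (x≢a x≡a)
    ... | no _    = refl

    -- The number of factors aa in `c ∷ w`, as a sum of products of indicators. Taking the last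
    -- letter of `w` for `c` makes the count cyclic.
    repeats : A → List A → ℕ
    repeats c []      = 0
    repeats c (x ∷ w) = [ c ≡a] * [ x ≡a] + repeats x w

    -- A block a contributes its repeat when the next block is read: the letters c before w and the last
    -- letter of c ∷ w account for the blocks at the two ends, and they cancel once w closes up to a cycle.
    repeats-blocks : ∀ {n w} → Blocks a n w → ∀ c →
      repeats c w + [ lookup (c ∷ w) (fromℕ (length w)) ≡a] ≡ n + [ c ≡a]
    repeats-blocks [] c = refl
    repeats-blocks {suc n} {_ ∷ w} (single ws) c = begin
      [ c ≡a] * [ a ≡a] + repeats a w + l ≡⟨ +-assoc ([ c ≡a] * [ a ≡a]) (repeats a w) l ⟩
      [ c ≡a] * [ a ≡a] + (repeats a w + l) ≡⟨ cong ([ c ≡a] * [ a ≡a] +_) (repeats-blocks ws a) ⟩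
      [ c ≡a] * [ a ≡a] + (n + [ a ≡a]) ≡⟨ cong (λ x → [ c ≡a] * x + (n + x)) [a≡a] ⟩
      [ c ≡a] * 1 + (n + 1) ≡⟨ solve 2 (λ x n → x :* con 1 :+ (n :+ con 1) := con 1 :+ n :+ x) refl [ c ≡a] n ⟩
      suc n + [ c ≡a] ∎
      where
      open ≡-Reasoning
      open +-*-Solver
      l : ℕ
      l = [ lookup (a ∷ w) (fromℕ (length w)) ≡a]
    repeats-blocks {n} {_ ∷ b ∷ w} (pair b≢ ws) c = begin
      [ c ≡a] * [ a ≡a] + ([ a ≡a] * [ b ≡a] + repeats b w) + l
        ≡⟨ cong₂ (λ x y → [ c ≡a] * x + (x * y + repeats b w) + l) [a≡a] (≢⇒[≡a] b≢) ⟩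
      [ c ≡a] * 1 + repeats b w + l
        ≡⟨ solve 3 (λ x y z → x :* con 1 :+ y :+ z := y :+ z :+ x) refl [ c ≡a] (repeats b w) l ⟩
      repeats b w + l + [ c ≡a]
        ≡⟨ cong (_+ [ c ≡a]) (repeats-blocks ws b) ⟩
      n + [ b ≡a] + [ c ≡a]
        ≡⟨ cong (λ x → n + x + [ c ≡a]) (≢⇒[≡a] b≢) ⟩
      n + 0 + [ c ≡a]
        ≡⟨ cong (_+ [ c ≡a]) (+-identityʳ n) ⟩
      n + [ c ≡a] ∎
      where
      open ≡-Reasoning
      open +-*-Solver
      l : ℕ
      l = [ lookup (b ∷ w) (fromℕ (length w)) ≡a]

    -- The map `h` is arbitrary so that the induction can pass to `h ∘ suc`, with `x` as the new
    -- preceding letter.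
    filter-repeats : ∀ {B : Set} {P : B → Set} (P? : Decidable P) c w (h : Fin (length w) → B) →
      (∀ i → P (h i) ⇔ (lookup (c ∷ w) (inject₁ i) ≡ a × lookup w i ≡ a)) →
      length (filter P? (tabulate h)) ≡ repeats c w
    filter-repeats P? c []      h P⇔ = refl
    filter-repeats P? c (x ∷ w) h P⇔
      with P? (h zero) | c ≟A a | x ≟A a | filter-repeats P? x w (h ∘ suc) (P⇔ ∘ suc)
    ... | yes p | yes _   | yes _   | ih = cong suc ih
    ... | yes p | no c≢a  | _       | ih = ⊥-elim (c≢a (proj₁ (Equivalence.to (P⇔ zero) p)))
    ... | yes p | yes _   | no x≢a  | ih = ⊥-elim (x≢a (proj₂ (Equivalence.to (P⇔ zero) p)))
    ... | no ¬p | yes c≡a | yes x≡a | ih = ⊥-elim (¬p (Equivalence.from (P⇔ zero) (c≡a , x≡a)))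
    ... | no ¬p | yes _   | no _    | ih = ih
    ... | no ¬p | no _    | _       | ih = ih

-- Successors and distances around a cycle.

module _ {A : Set} {N : ℕ} .{{_ : NonZero N}} (C : Cycle N A) where

  at-toℕ : ∀ j → C at toℕ j ≡ C j
  at-toℕ j = cong C (toℕ-injective (trans (toℕ-fromℕ< _) (m<n⇒m%n≡m (toℕ<n j))))

  at-N : C at N ≡ C at 0
  at-N = cong C (toℕ-injective (begin
    toℕ (N mod N) ≡⟨ toℕ-fromℕ< _ ⟩
    N % N         ≡⟨ [m+n]%n≡m%n 0 N ⟩
    0 % N         ≡⟨ toℕ-fromℕ< _ ⟨
    toℕ (0 mod N) ∎))
    where open ≡-Reasoning

  at-suc-mod : ∀ s → C at suc (toℕ (s mod N)) ≡ C at suc s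
  at-suc-mod s = cong C (toℕ-injective (begin
    toℕ (suc (toℕ (s mod N)) mod N) ≡⟨ toℕ-fromℕ< _ ⟩
    suc (toℕ (s mod N)) % N         ≡⟨ cong (λ r → suc r % N) (toℕ-fromℕ< (m%n<n s N)) ⟩
    (1 + s % N) % N                 ≡⟨ %-distribˡ-+ 1 (s % N) N ⟩
    (1 % N + s % N % N) % N         ≡⟨ cong (λ r → (1 % N + r) % N) (m%n%n≡m%n s N) ⟩
    (1 % N + s % N) % N             ≡⟨ %-distribˡ-+ 1 s N ⟨
    suc s % N                       ≡⟨ toℕ-fromℕ< _ ⟨
    toℕ (suc s mod N)               ∎))
    where open ≡-Reasoning

  module _ (_≟A_ : DecidableEquality A) (j : Fin N) where

    private
      Δj : ℕ
      Δj = Δ _≟A_ C j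

      Δj-returns : Returns C j Δj
      Δj-returns = proj₁ (proj₂ (nextReturn _≟A_ C j))

      Δj-least : ∀ {d} → Returns C j d → Δj ≤ d
      Δj-least = proj₂ (proj₂ (nextReturn _≟A_ C j))

      at-+1 : C at (toℕ j + 1) ≡ C at suc (toℕ j)
      at-+1 = cong (C at_) (+-comm (toℕ j) 1)

      at-+2 : C at (toℕ j + 2) ≡ C at suc (suc (toℕ j))
      at-+2 = cong (C at_) (+-comm (toℕ j) 2)

    -- The distance is the least return and is at least 1, so it equals 1 exactly when 1 is itself a
    -- return.
    Δ≡1⇔ : Δj ≡ 1 ⇔ C at suc (toℕ j) ≡ C j
    Δ≡1⇔ = mk⇔
      (λ Δ≡1 → trans (sym at-+1) (proj₂ (subst (Returns C j) Δ≡1 Δj-returns)))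
      (λ eq → ≤-antisym (Δj-least (s≤s z≤n , trans at-+1 eq)) (proj₁ Δj-returns))

    Δ≡2 : Δj ≢ 1 → C at suc (suc (toℕ j)) ≡ C j → Δj ≡ 2
    Δ≡2 Δ≢1 eq = ≤-antisym (Δj-least (s≤s z≤n , trans at-+2 eq))
                           (≤∧≢⇒< (proj₁ Δj-returns) (≢-sym Δ≢1))

module _ {A : Set} (_≟A_ : DecidableEquality A) {a : A} {n : ℕ} where

  blocks-Δ : ∀ {N} .{{_ : NonZero N}} w (eq : length w ≡ N) → Blocks a n w →
    let C = wordCycle w eq in
    count (λ j → (C j ≟A a) ×-dec (Δ _≟A_ C j ≟ 1)) ≡ n
    × (∀ j → C j ≡ a → Δ _≟A_ C j ≢ 1 → Δ _≟A_ C j ≡ 2)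
  blocks-Δ w refl ws =
      trans (filter-repeats _≟A_ _ c w (λ j → j) single⇔) repeats≡n
    , λ j Cj≡a Δ≢1 → Δ≡2 C _≟A_ j Δ≢1 (trans (next-next j Cj≡a Δ≢1) (sym Cj≡a))
    where
    C : Cycle (length w) A
    C = wordCycle w refl

    -- Position 0 carries the last letter of `w`, so `c ∷ w` lists C_0, ..., C_N, and index i of `w`
    -- is position i + 1 of the cycle.
    c : A
    c = C at 0

    lookup-at : ∀ i → lookup (c ∷ w) i ≡ C at toℕ i
    lookup-at zero    = refl
    lookup-at (suc i) = sym (wordCycle-letter w refl i)

    lookup-C : ∀ j → lookup (c ∷ w) (inject₁ j) ≡ C j
    lookup-C j = trans (lookup-at (inject₁ j))
                       (trans (cong (C at_) (toℕ-inject₁ j)) (at-toℕ C j))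

    last≡c : lookup (c ∷ w) (fromℕ (length w)) ≡ c
    last≡c = trans (lookup-at (fromℕ (length w)))
                   (trans (cong (C at_) (toℕ-fromℕ (length w))) (at-N C))

    repeats≡n : repeats _≟A_ c w ≡ n
    -- The boundary terms of `repeats-blocks` cancel because `c ∷ w` both begins and ends with `c`.
    repeats≡n = +-cancelʳ-≡ ([_≡a] _≟A_ c) (repeats _≟A_ c w) n
      (trans (cong (λ x → repeats _≟A_ c w + [_≡a] _≟A_ x) (sym last≡c))
             (repeats-blocks _≟A_ ws c))

    single⇔ : ∀ j → (C j ≡ a × Δ _≟A_ C j ≡ 1) ⇔ (lookup (c ∷ w) (inject₁ j) ≡ a × lookup w j ≡ a)
    single⇔ j = mk⇔
      (λ (Cj≡a , Δ≡1) → trans (lookup-C j) Cj≡a ,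
         trans (lookup-at (suc j)) (trans (Equivalence.to (Δ≡1⇔ C _≟A_ j) Δ≡1) Cj≡a))
      (λ (l≡a , next≡a) → let Cj≡a = trans (sym (lookup-C j)) l≡a in
         Cj≡a , Equivalence.from (Δ≡1⇔ C _≟A_ j)
                  (trans (sym (lookup-at (suc j))) (trans next≡a (sym Cj≡a))))

    -- As the distance is not 1, the letter at `j⁺` is not a, and `after-other` gives the letter
    -- following it. If `j⁺` wraps around to 0, that letter is the first of `w`, preceded by `c`.
    next-next : ∀ j → C j ≡ a → Δ _≟A_ C j ≢ 1 → C at suc (suc (toℕ j)) ≡ a
    next-next j Cj≡a Δ≢1 = begin
      C at suc (suc (toℕ j)) ≡⟨ at-suc-mod C (suc (toℕ j)) ⟨
      C at suc (toℕ j⁺)      ≡⟨ lookup-at (suc j⁺) ⟨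
      lookup w j⁺            ≡⟨ after-other ws c j⁺ (λ l≡a → Δ≢1 (Equivalence.from (Δ≡1⇔ C _≟A_ j)
                                  (trans (sym (lookup-C j⁺)) (trans l≡a (sym Cj≡a))))) ⟩
      a                      ∎
      where
      open ≡-Reasoning
      j⁺ : Fin (length w)
      j⁺ = suc (toℕ j) mod length w

corollary2 : (S : CyclicSequencingProblem) → let open CyclicSequencingProblem S in
    (k : Fin 2) (k-more : MoreAbundant k) →
    let C = ESA k k-more in
    count (λ j → (C j ≟ˢ symbol k) ×-dec (Δ _≟ˢ_ C j ≟ 1)) ≡ ∣ m 0F - m 1F ∣
    × (∀ (j : Fin N) → C j ≡ symbol k → Δ _≟ˢ_ C j ≢ 1 → Δ _≟ˢ_ C j ≡ 2)
corollary2 S k k-more =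
  blocks-Δ _≟ˢ_ (esaWord k) (length-esaWord k)
    (blocks-cast (difference k k-more)
      -- Injectivity of the alphabet makes the two symbols distinct.
      (blocks-esa (opposite≢ k ∘ Injection.injective (↔⇒↣ alphabet)) (m k) (m (opposite k)) k-more
        (<-wellFounded _)))
  where
  open CyclicSequencingProblem S

  opposite≢ : (k : Fin 2) → opposite k ≢ k
  opposite≢ 0F ()
  opposite≢ 1F ()

  difference : ∀ k → MoreAbundant k → m k ∸ m (opposite k) ≡ ∣ m 0F - m 1F ∣
  difference 0F le = sym (m≤n⇒∣n-m∣≡n∸m le)
  difference 1F le = sym (m≤n⇒∣m-n∣≡n∸m le)
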